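{- Every well-specified game has a pure-strategy Nash equilibrium. That is: let $I$ be a (possibly infinite) index set with at least two elements, and consider a game with strategy spaces $(S_i)_{i\in I}$ and best-response correspondences $\mathrm{BR}_i\colon S_{ -i}\to C(S_i)$, $i\in I$. If the game is well-specified, then there exists a point $s\in S=\prod_{i\in I}S_i$ such that $s_i\in \mathrm{BR}_i(s_{ -i})$ for every $i\in I$.
   Context: Hyperspace: for a topological space $X$, $C(X)$ denotes the set of nonempty closed subsets of $X$, equipped with the upper Vietoris topology, which has as a basis the sets $\{K\in C(X)\colon K\subset U\}$ with $U\subset X$ open. Preregular: two points of a topological space are topologically distinguishable if there is an open set containing one but not the other; a space is preregular if any two topologically distinguishable points can be separated by disjoint open neighborhoods. Compact does not include Hausdorff. Game: a family of nonempty topological spaces $(S_i)_{i\in I}$ (strategy spaces), indexed by a possibly infinite set $I$ containing at least two elements, together with, for each $i\in I$, a best-response correspondence, which is a continuous function $\mathrm{BR}_i\colon S_{ -i}\to C(S_i)$. Here $S=\prod_{i\in I}S_i$ and $S_{ -i}=\prod_{j\neq i}S_j$ carry the product topologies. For $s\in S$, $s_i$ is its $i$th coordinate and $s_{ -i}\in S_{ -i}$ is $s$ with the $i$th coordinate removed. Pure-strategy Nash equilibrium: a point $s\in S$ with $s_i\in \mathrm{BR}_i(s_{ -i})$ for every $i\in I$. Reduction: for $J\subset I$ with at least two elements, let $S_J=\prod_{i\in J}S_i$ and $S_{ -J}=\prod_{i\in I\setminus J}S_i$. For a point $p\in S_{ -J}$, the reduction around $p$ is the game with index set $J$, strategy spaces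 $S_i$ ($i\in J$), and best-response correspondences $\mathrm{BR}_i(p,\cdot)\colon \prod_{j\in J\setminus\{i\}}S_j\to C(S_i)$ ($i\in J$), i.e. the players outside $J$ have their strategies fixed to be those given by $p$. If $J=I$, the unique corresponding reduction is the original game. A reduction is finite if $J$ is finite. Well-specified: a game is well-specified if (1) each $S_i$ is nonempty, preregular, and compact; (2) each best-response correspondence $\mathrm{BR}_i$ is continuous; and (3) every finite reduction has a pure-strategy Nash equilibrium. The axiom of choice is assumed for this statement. -}

module Defs where

open import Data.Fin.Base using (Fin)
open import Data.Irrelevant using ([_]) renaming (map to map-irr)
open import Data.List.Base using (List; []; _∷_; _++_; foldr)
open import Data.List.Relation.Unary.Any using (Any)
open import Data.Product using (Σ; Σ-syntax; ∃; ∃₂; ∃-syntax; _×_; _,_; proj₁; proj₂)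
open import Data.Refinement using (Refinement; Refinement-syntax; _,_; value)
open import Data.Sum.Base using (_⊎_)
open import Data.Unit.Polymorphic using (⊤; tt)
open import Function.Base using (_∘_)
open import Function.Bundles using (_↔_)
open import Level using (Level; suc; _⊔_)
open import Relation.Binary.PropositionalEquality using (_≡_; _≢_; cong)
open import Relation.Nullary using (Dec; yes; no)
open import Relation.Unary
  using (Pred; Decidable; Satisfiable; _∈_; _∉_; _⊆_; _≐_; _∩_; _⊥_; _⊢_; ∁; ⋃)

private
  variable
    a c c′ ℓ : Level

-- A choice function on the nonempty subsets of A.  As in set theory, the
-- chosen point depends only on the extension of the subset: this is what makes
-- the principle stronger than the (provable) choice principle for Σ-types.
AxiomOfChoice : ∀ a ℓ → Set (suc (a ⊔ ℓ))
AxiomOfChoice a ℓ =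
  (A : Set a) →
  Σ[ choose ∈ ((P : Pred A ℓ) → Satisfiable P → A) ]
    (∀ P (ne : Satisfiable P) → choose P ne ∈ P) ×
    (∀ P Q (neP : Satisfiable P) (neQ : Satisfiable Q) →
       P ≐ Q → choose P neP ≡ choose Q neQ)

AtLeastTwo : Set a → Set a
AtLeastTwo A = ∃₂ λ (x y : A) → x ≢ y

Finite : Set a → Set a
Finite A = ∃[ n ] (Fin n ↔ A)

whole : {X : Set c} → Pred X ℓ
whole _ = ⊤

-- Subsets are predicates, so openness must be required to be invariant under
-- extensional equality.  Openness of the empty set is the empty union.
record TopologicalSpace c ℓ : Set (suc (c ⊔ suc ℓ)) where
  field
    Carrier     : Set c
    Open        : Pred (Pred Carrier ℓ) (c ⊔ suc ℓ)
    Open-resp-≐ : ∀ {U V} → U ≐ V → Open U → Open V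
    whole-open  : Open whole
    ∩-open      : ∀ {U V} → Open U → Open V → Open (U ∩ V)
    ⋃-open      : (A : Set ℓ) (U : A → Pred Carrier ℓ) →
                  (∀ α → Open (U α)) → Open (⋃ A U)

  Closed : Pred (Pred Carrier ℓ) (c ⊔ suc ℓ)
  Closed K = Open (∁ K)

  Opens : Set (c ⊔ suc ℓ)
  Opens = Σ (Pred Carrier ℓ) Open

  Distinguishable : Carrier → Carrier → Set (c ⊔ suc ℓ)
  Distinguishable x y =
    ∃[ U ] Open U × ((x ∈ U × y ∉ U) ⊎ (x ∉ U × y ∈ U))

  Preregular : Set (c ⊔ suc ℓ)
  Preregular = ∀ x y → Distinguishable x y →
    ∃₂ λ U V → Open U × Open V × x ∈ U × y ∈ V × U ⊥ V

  Compact : Set (c ⊔ suc ℓ)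
  Compact = (A : Set ℓ) (U : A → Pred Carrier ℓ) → (∀ α → Open (U α)) →
    (∀ x → x ∈ ⋃ A U) → ∃[ αs ] ∀ x → Any (λ α → x ∈ U α) αs

open TopologicalSpace using (Carrier)

record ContinuousMap (X : TopologicalSpace c ℓ) (Y : TopologicalSpace c′ ℓ) :
       Set (c ⊔ c′ ⊔ suc ℓ) where
  private
    module X = TopologicalSpace X
    module Y = TopologicalSpace Y
  field
    to         : X.Carrier → Y.Carrier
    continuous : ∀ V → Y.Open V → X.Open (to ⊢ V)

_∘ᶜ_ : ∀ {c″} {X : TopologicalSpace c ℓ} {Y : TopologicalSpace c′ ℓ}
       {Z : TopologicalSpace c″ ℓ} →
       ContinuousMap Y Z → ContinuousMap X Y → ContinuousMap X Z
g ∘ᶜ f = record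
  { to         = g.to ∘ f.to
  ; continuous = λ V Vo → f.continuous (g.to ⊢ V) (g.continuous V Vo)
  }
  where
    module g = ContinuousMap g
    module f = ContinuousMap f

record IsBasis {X : Set c} {B : Set (suc ℓ)} (N : B → Pred X ℓ) :
       Set (c ⊔ suc ℓ) where
  field
    covers : ∀ x → ∃[ b ] x ∈ N b
    meets  : ∀ b b′ {x} → x ∈ N b → x ∈ N b′ →
             ∃[ d ] x ∈ N d × N d ⊆ N b ∩ N b′

fromBasis : {X : Set c} {B : Set (suc ℓ)} (N : B → Pred X ℓ) →
            IsBasis N → TopologicalSpace c ℓ
fromBasis {X = X} N isBasis = record
  { Carrier     = X
  ; Open        = λ U → ∀ x → x ∈ U → ∃[ b ] x ∈ N b × N b ⊆ U
  ; Open-resp-≐ = λ (U⊆V , V⊆U) Uo x x∈V →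
      let b , x∈b , b⊆U = Uo x (V⊆U x∈V) in b , x∈b , λ y∈b → U⊆V (b⊆U y∈b)
  ; whole-open  = λ x _ → let b , x∈b = covers x in b , x∈b , λ _ → tt
  ; ∩-open      = λ Uo Vo x (x∈U , x∈V) →
      let b  , x∈b  , b⊆U  = Uo x x∈U
          b′ , x∈b′ , b′⊆V = Vo x x∈V
          d  , x∈d  , d⊆   = meets b b′ x∈b x∈b′
      in d , x∈d , λ y∈d → b⊆U (proj₁ (d⊆ y∈d)) , b′⊆V (proj₂ (d⊆ y∈d))
  ; ⋃-open      = λ A U Uo x (α , x∈Uα) →
      let b , x∈b , b⊆Uα = Uo α x x∈Uα in b , x∈b , λ y∈b → α , b⊆Uα y∈b
  }
  where open IsBasis isBasis

module _ {I : Set ℓ} (S : I → TopologicalSpace ℓ ℓ) where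

  private
    module S i = TopologicalSpace (S i)

  Point : Set ℓ
  Point = ∀ i → S.Carrier i

  Cylinder : Set (suc ℓ)
  Cylinder = Σ[ i ∈ I ] S.Opens i

  cylinder : Cylinder → Pred Point ℓ
  cylinder (i , U , _) s = s i ∈ U

  box : List Cylinder → Pred Point ℓ
  box = foldr (λ Z B → cylinder Z ∩ B) whole

  box-++⁺ : ∀ Zs Ws {s} → s ∈ box Zs → s ∈ box Ws → s ∈ box (Zs ++ Ws)
  box-++⁺ []       Ws _         q = q
  box-++⁺ (_ ∷ Zs) Ws (p , ps)  q = p , box-++⁺ Zs Ws ps q

  box-++⁻ : ∀ Zs Ws {s} → s ∈ box (Zs ++ Ws) → s ∈ box Zs × s ∈ box Ws
  box-++⁻ []       Ws q        = tt , q
  box-++⁻ (_ ∷ Zs) Ws (p , ps) =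
    let ps′ , q = box-++⁻ Zs Ws ps in (p , ps′) , q

  box-isBasis : IsBasis box
  box-isBasis = record
    { covers = λ _ → [] , tt
    ; meets  = λ Zs Ws p q → Zs ++ Ws , box-++⁺ Zs Ws p q , box-++⁻ Zs Ws
    }

  ∏ : TopologicalSpace ℓ ℓ
  ∏ = fromBasis box box-isBasis

  π : ∀ i → ContinuousMap ∏ (S i)
  π i = record
    { to         = λ s → s i
    ; continuous = λ U Uo s s∈U → ((i , U , Uo) ∷ []) , (s∈U , tt) , proj₁
    }

  module _ {X : TopologicalSpace ℓ ℓ} (f : ∀ i → ContinuousMap X (S i)) where

    private
      module X = TopologicalSpace X
      module f i = ContinuousMap (f i)

      pair : X.Carrier → Point
      pair x i = f.to i x

      box-preimage : ∀ Zs → X.Open (pair ⊢ box Zs)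
      box-preimage []                  = X.whole-open
      box-preimage ((i , U , Uo) ∷ Zs) =
        X.∩-open (f.continuous i U Uo) (box-preimage Zs)

    ⟨_⟩ : ContinuousMap X ∏
    ⟨_⟩ = record
      { to         = pair
      ; continuous = λ V Vo → X.Open-resp-≐
          ( (λ { ((x , p) , y∈) → proj₂ (proj₂ (Vo (pair x) p)) y∈ })
          , (λ {y} p → (y , p) , proj₁ (proj₂ (Vo (pair y) p))) )
          (X.⋃-open (∃ (pair ⊢ V))
            (λ (x , p) → pair ⊢ box (proj₁ (Vo (pair x) p)))
            (λ (x , p) → box-preimage (proj₁ (Vo (pair x) p))))
      }

const : {X Y : TopologicalSpace ℓ ℓ} → Carrier Y → ContinuousMap X Y
const {X = X} y = record
  { to         = λ _ → y
  ; continuous = λ V _ → X.Open-resp-≐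
      ((λ (y∈V , _) → y∈V) , (λ y∈V → y∈V , tt))
      (X.⋃-open (y ∈ V) (λ _ → whole) (λ _ → X.whole-open))
  }
  where module X = TopologicalSpace X

module _ (X : TopologicalSpace ℓ ℓ) where

  private
    module X = TopologicalSpace X

  record ClosedSubset : Set (suc ℓ) where
    field
      set      : Pred X.Carrier ℓ
      closed   : X.Closed set
      nonempty : Satisfiable set

  open ClosedSubset

  subsetsOf : X.Opens → Pred ClosedSubset ℓ
  subsetsOf (U , _) K = set K ⊆ U

  subsetsOf-isBasis : IsBasis subsetsOf
  subsetsOf-isBasis = record
    { covers = λ _ → (whole , X.whole-open) , λ _ → tt
    ; meets  = λ (U , Uo) (V , Vo) K⊆U K⊆V →
        (U ∩ V , X.∩-open Uo Vo)
        , (λ x∈K → K⊆U x∈K , K⊆V x∈K)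
        , (λ L⊆ → (λ x∈L → proj₁ (L⊆ x∈L)) , (λ x∈L → proj₂ (L⊆ x∈L)))
    }

  -- The upper Vietoris topology.
  Hyperspace : TopologicalSpace (suc ℓ) ℓ
  Hyperspace = fromBasis subsetsOf subsetsOf-isBasis

-- I ∖ {i}; membership proofs in a refinement type are irrelevant, so its
-- elements are determined by their values.
Others : {I : Set ℓ} → I → Set ℓ
Others {I = I} i = [ j ∈ I ∣ j ≢ i ]

∏₋ : {I : Set ℓ} → (I → TopologicalSpace ℓ ℓ) → I → TopologicalSpace ℓ ℓ
∏₋ S i = ∏ λ (j : Others i) → S (value j)

record Game ℓ : Set (suc (suc ℓ)) where
  field
    Player     : Set ℓ
    twoPlayers : AtLeastTwo Player
    S          : Player → TopologicalSpace ℓ ℓ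
    S-nonempty : ∀ i → Carrier (S i)
    BR         : ∀ i → ContinuousMap (∏₋ S i) (Hyperspace (S i))

  Profile : Set ℓ
  Profile = Carrier (∏ S)

  _₋_ : Profile → ∀ i → Carrier (∏₋ S i)
  (s ₋ i) j = s (value j)

  bestResponses : ∀ i → Carrier (∏₋ S i) → Pred (Carrier (S i)) ℓ
  bestResponses i t = ClosedSubset.set (ContinuousMap.to (BR i) t)

  IsNash : Pred Profile ℓ
  IsNash s = ∀ i → s i ∈ bestResponses i (s ₋ i)

module Reduction (G : Game ℓ) (J : Pred (Game.Player G) ℓ) (J? : Decidable J) where

  open Game G

  Inside : Set ℓ
  Inside = [ i ∈ Player ∣ i ∈ J ]

  Outside : Set ℓ
  Outside = [ i ∈ Player ∣ i ∉ J ]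

  Sᴶ : Inside → TopologicalSpace ℓ ℓ
  Sᴶ i = S (value i)

  S₋ᴶ : Outside → TopologicalSpace ℓ ℓ
  S₋ᴶ i = S (value i)

  module _ (p : Carrier (∏ S₋ᴶ)) where

    coordinate : (i : Inside) (j : Others (value i)) → Dec (value j ∈ J) →
                 ContinuousMap (∏₋ Sᴶ i) (S (value j))
    coordinate i (j , j≢i) (yes j∈J) =
      π (λ (k : Others i) → Sᴶ (value k))
        ((j , [ j∈J ]) , map-irr (λ ne eq → ne (cong value eq)) j≢i)
    coordinate i (j , j≢i) (no  j∉J) = const (p (j , [ j∉J ]))

    -- q ↦ (p , q)
    extend : (i : Inside) → ContinuousMap (∏₋ Sᴶ i) (∏₋ S (value i))
    extend i = ⟨ (λ (j : Others (value i)) → S (value j)) ⟩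
                 λ j → coordinate i j (J? (value j))

    reduction : AtLeastTwo Inside → Game ℓ
    reduction two = record
      { Player     = Inside
      ; twoPlayers = two
      ; S          = Sᴶ
      ; S-nonempty = λ i → S-nonempty (value i)
      ; BR         = λ i → BR (value i) ∘ᶜ extend i
      }

open Reduction using (Inside; S₋ᴶ; reduction)

-- Nonemptiness of the strategy spaces and continuity of the best responses are
-- part of the definition of a game.  Subsets J are taken with decidable
-- membership, which under excluded middle is no restriction.
record WellSpecified (G : Game ℓ) : Set (suc ℓ) where
  open Game G
  field
    preregular : ∀ i → TopologicalSpace.Preregular (S i)
    compact    : ∀ i → TopologicalSpace.Compact (S i)
    finiteNash : ∀ (J : Pred Player ℓ) (J? : Decidable J)
                 (two : AtLeastTwo (Inside G J J?)) → Finite (Inside G J J?) →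
                 (p : Carrier (∏ (S₋ᴶ G J J?))) →
                 Satisfiable (Game.IsNash (reduction G J J? p two))

{-# OPTIONS --safe #-}

-- In a compact preregular space points can be separated from closed sets, so
-- each set { s : sᵢ ∈ BRᵢ(s₋ᵢ) } is closed in the product.  The equilibria of
-- the finite reductions show that these sets have the finite intersection
-- property, and Tychonoff's theorem provides a common point.
--
-- For Tychonoff's theorem, take a maximal collection M of subbasic open sets
-- whose finite intersections all meet every finite intersection of the given
-- closed sets.  By compactness, each factor has a point all of whose open
-- neighbourhoods give cylinders in M; these points form the common point.
module Submission where

open import Axiom.ExcludedMiddle using (ExcludedMiddle)
open import Data.Empty using (⊥-elim)
open import Data.Fin.Base using (zero; suc)
open import Data.Irrelevant using ([_])
open import Data.List.Base using (List; []; _∷_; _++_; lookup; deduplicate)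
open import Data.List.Membership.Propositional using () renaming (_∈_ to _∈ˡ_)
open import Data.List.Membership.Propositional.Properties
  using (∈-lookup; ∈-deduplicate⁺)
open import Data.List.Relation.Unary.All as All using (All; []; _∷_)
open import Data.List.Relation.Unary.All.Properties using (++⁺; ++⁻)
open import Data.List.Relation.Unary.Any as Any using (Any; here; there)
open import Data.List.Relation.Unary.Any.Properties using (lookup-index)
open import Data.List.Relation.Unary.Unique.Propositional using (Unique; []; _∷_)
open import Data.List.Relation.Unary.Unique.DecPropositional.Properties
  using (deduplicate-!)
open import Data.Maybe.Base using (Maybe; just; nothing)
open import Data.Product
  using (Σ-syntax; ∃; ∃₂; ∃-syntax; _×_; _,_; proj₁; proj₂)
open import Data.Refinement using (Refinement-syntax; _,_; value; value-injective)
open import Data.Sum.Base using (_⊎_; inj₁; inj₂)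
open import Data.Unit.Polymorphic using (tt)
open import Function.Base using (id; _∘_; case_of_)
open import Function.Bundles using (mk↔ₛ′)
open import Level using (Level; 0ℓ; _⊔_) renaming (suc to lsuc)
open import Relation.Binary.PropositionalEquality
  using (_≡_; refl; sym; cong; subst)
open import Relation.Nullary using (Dec; yes; no; ¬_; contradiction)
open import Relation.Nullary.Decidable
  using (True; toWitness; fromWitness; decidable-stable; recompute)
open import Relation.Unary
  using (Pred; Decidable; Satisfiable; _∈_; _∉_; _⊆_; _≐_; _∩_; _⊥_; _⊢_; ∁; ⋃)

open import Defs

private
  variable
    a c p ℓ : Level

lookup-injective : {A : Set a} {xs : List A} → Unique xs →
                   ∀ i j → lookup xs i ≡ lookup xs j → i ≡ j
lookup-injective (_ ∷ _)   zero    zero    _  = refl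
lookup-injective (x∉ ∷ _)  zero    (suc j) eq =
  contradiction eq (All.lookup x∉ (∈-lookup j))
lookup-injective (x∉ ∷ _)  (suc i) zero    eq =
  contradiction (sym eq) (All.lookup x∉ (∈-lookup i))
lookup-injective (_ ∷ xs!) (suc i) (suc j) eq =
  cong suc (lookup-injective xs! i j eq)

module _ (em : ∀ {a} → ExcludedMiddle a) where

  by-contradiction : {P : Set p} → ¬ ¬ P → P
  by-contradiction = decidable-stable em

  ¬∀⇒∃¬ : {A : Set a} {P : Pred A p} → ¬ (∀ x → x ∈ P) → ∃[ x ] x ∉ P
  ¬∀⇒∃¬ ¬∀ = by-contradiction λ ¬∃ →
    ¬∀ λ x → by-contradiction λ x∉P → ¬∃ (x , x∉P)

  -- Excluded middle entails propositional resizing.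
  Resize : Set p → Set
  Resize P = True (em {P = P})

  -- The Teichmüller-Tukey lemma, by a Bourbaki-Witt tower argument.

  module Teichmüller–Tukey (ac : ∀ {a b} → AxiomOfChoice a b)
    {A : Set a} (Consistent : Pred (List A) c) where

    -- Level 0 keeps subsets closed under `⋃ₛ`, which quantifies over families of subsets; `Resize`
    -- lowers the membership statements.
    Subset : Set (a ⊔ lsuc 0ℓ)
    Subset = Pred A 0ℓ

    FinitelyConsistent : Pred Subset (a ⊔ c)
    FinitelyConsistent F = ∀ xs → All F xs → Consistent xs

    adjoin : A → Subset → Subset
    adjoin x F y = y ∈ F ⊎ Resize (y ≡ x)

    Extends : Subset → Pred A (a ⊔ c)
    Extends F x = x ∉ F × FinitelyConsistent (adjoin x F)

    choose : (P : Pred A (a ⊔ c)) → Satisfiable P → A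
    choose = proj₁ (ac A)

    adjoin-chosen : (F : Subset) → Dec (Satisfiable (Extends F)) → Subset
    adjoin-chosen F (yes ne) = adjoin (choose (Extends F) ne) F
    adjoin-chosen F (no  _)  = F

    next : Subset → Subset
    next F = adjoin-chosen F em

    next-⊇ : ∀ F → F ⊆ next F
    next-⊇ F = go em
      where
      go : ∀ d → F ⊆ adjoin-chosen F d
      go (yes _) = inj₁
      go (no  _) = id

    adjoin-mono : ∀ x {F G} → F ⊆ G → adjoin x F ⊆ adjoin x G
    adjoin-mono _ F⊆G (inj₁ y∈F) = inj₁ (F⊆G y∈F)
    adjoin-mono _ F⊆G (inj₂ y≡x) = inj₂ y≡x

    Extends-resp : ∀ {F G} → F ≐ G → Extends F ⊆ Extends G
    Extends-resp {F} {G} (F⊆G , G⊆F) {x} (x∉F , con) =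
      (λ x∈G → x∉F (G⊆F x∈G)) ,
      λ xs xs∈ → con xs (All.map (adjoin-mono x {G} {F} G⊆F) xs∈)

    -- Extensionality of choice makes both sides adjoin the same point. It is needed because
    -- comparisons in the tower yield mutual inclusion, not equality of predicates.
    next-resp : ∀ {F G} → F ≐ G → next F ⊆ next G
    next-resp {F} {G} F≐G@(F⊆G , G⊆F) = go em em
      where
      go : ∀ d e → adjoin-chosen F d ⊆ adjoin-chosen G e
      go (yes neF) (yes neG) {y} y∈ = subst (λ x → y ∈ adjoin x G)
        (proj₂ (proj₂ (ac A)) (Extends F) (Extends G) neF neG
          (Extends-resp F≐G , Extends-resp (G⊆F , F⊆G)))
        (adjoin-mono _ {F} {G} F⊆G y∈)
      go (yes (x , ext)) (no ¬ne) =
        contradiction (x , Extends-resp F≐G ext) ¬ne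
      go (no ¬ne) (yes (x , ext)) =
        contradiction (x , Extends-resp (G⊆F , F⊆G) ext) ¬ne
      go (no _) (no _) = F⊆G

    ⋃ₛ : Pred Subset 0ℓ → Subset
    ⋃ₛ C x = Resize (∃[ F ] F ∈ C × x ∈ F)

    ⋃ₛ-upper : ∀ C {F} → F ∈ C → F ⊆ ⋃ₛ C
    ⋃ₛ-upper C F∈C x∈F = fromWitness (_ , F∈C , x∈F)

    ⋃ₛ-least : ∀ C {G : Subset} → (∀ {F} → F ∈ C → F ⊆ G) → ⋃ₛ C ⊆ G
    ⋃ₛ-least C ub x∈ = let _ , F∈C , x∈F = toWitness x∈ in ub F∈C x∈F

    -- The transfinite iterates of next starting from ∅, which is the union of
    -- the empty family.
    data Tower : Pred Subset (a ⊔ lsuc 0ℓ) where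
      step  : ∀ {F} → F ∈ Tower → next F ∈ Tower
      union : ∀ C → (∀ {F} → F ∈ C → F ∈ Tower) → ⋃ₛ C ∈ Tower

    -- The extreme elements of the Bourbaki-Witt argument, with strict inclusion spelled as `F ⊆ G`
    -- and `¬ G ⊆ F`.
    Extreme : Pred Subset (a ⊔ lsuc 0ℓ)
    Extreme G = ∀ {F} → F ∈ Tower → F ⊆ G → ¬ G ⊆ F → next F ⊆ G

    -- Induction on the tower: below `G`, extremality keeps `next F` inside `G` unless `F` already
    -- equals `G`; a union has a member above `next G` or only members below `G`.
    extreme-compare : ∀ {F G} → G ∈ Extreme → F ∈ Tower →
                      F ⊆ G ⊎ next G ⊆ F
    extreme-compare {G = G} ext (step {F} F∈T) with extreme-compare ext F∈T
    ... | inj₂ nG⊆F = inj₂ (next-⊇ F ∘ nG⊆F)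
    ... | inj₁ F⊆G with em {P = G ⊆ F}
    ...   | yes G⊆F = inj₂ (next-resp (G⊆F , F⊆G))
    ...   | no  G⊈F = inj₁ (ext F∈T F⊆G G⊈F)
    extreme-compare {G = G} ext (union C C⊆T)
      with em {P = ∃[ F ] F ∈ C × next G ⊆ F}
    ... | yes (F , F∈C , nG⊆F) = inj₂ (⋃ₛ-upper C F∈C ∘ nG⊆F)
    ... | no  ¬∃ = inj₁ (⋃ₛ-least C λ F∈C →
      case extreme-compare ext (C⊆T F∈C) of λ where
        (inj₁ F⊆G)  → F⊆G
        (inj₂ nG⊆F) → ⊥-elim (¬∃ (_ , F∈C , nG⊆F)))

    tower-extreme : ∀ {G} → G ∈ Tower → G ∈ Extreme
    tower-extreme (step {G} G∈T) {F} F∈T F⊆nG nG⊈F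
      with extreme-compare (tower-extreme G∈T) F∈T
    ... | inj₂ nG⊆F = ⊥-elim (nG⊈F nG⊆F)
    ... | inj₁ F⊆G with em {P = G ⊆ F}
    ...   | yes G⊆F = next-resp (F⊆G , G⊆F)
    ...   | no  G⊈F = next-⊇ G ∘ tower-extreme G∈T F∈T F⊆G G⊈F
    tower-extreme (union C C⊆T) {F} F∈T F⊆⋃ ⋃⊈F
      with em {P = ∃[ G ] G ∈ C × F ⊆ G}
    ... | no ¬∃ = ⊥-elim (⋃⊈F (⋃ₛ-least C λ {G} G∈C →
      case extreme-compare (tower-extreme (C⊆T G∈C)) F∈T of λ where
        (inj₁ F⊆G)  → ⊥-elim (¬∃ (G , G∈C , F⊆G))
        (inj₂ nG⊆F) → nG⊆F ∘ next-⊇ G))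
    ... | yes (G , G∈C , F⊆G) with em {P = G ⊆ F}
    ...   | no  G⊈F =
      ⋃ₛ-upper C G∈C ∘ tower-extreme (C⊆T G∈C) F∈T F⊆G G⊈F
    -- Here `F` equals `G`, so extremality of `G` does not apply to `F`. Comparing `G` with the
    -- whole union yields `next G ⊆ ⋃ₛ C`, since the union is not inside `F`.
    ...   | yes G⊆F
      with extreme-compare (tower-extreme (C⊆T G∈C)) (union C C⊆T)
    ...     | inj₁ ⋃⊆G  = ⊥-elim (⋃⊈F (G⊆F ∘ ⋃⊆G))
    ...     | inj₂ nG⊆⋃ = nG⊆⋃ ∘ next-resp (F⊆G , G⊆F)

    tower-linear : ∀ {F G} → F ∈ Tower → G ∈ Tower → F ⊆ G ⊎ G ⊆ F
    tower-linear {G = G} F∈T G∈T with extreme-compare (tower-extreme G∈T) F∈T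
    ... | inj₁ F⊆G  = inj₁ F⊆G
    ... | inj₂ nG⊆F = inj₂ (nG⊆F ∘ next-⊇ G)

    -- By linearity, the largest of the members witnessing the entries holds the whole list. The
    -- list is nonempty because `C` may be empty.
    ⋃ₛ-finite : ∀ C → (∀ {F} → F ∈ C → F ∈ Tower) →
                ∀ x xs → All (⋃ₛ C) (x ∷ xs) → ∃[ F ] F ∈ C × All F (x ∷ xs)
    ⋃ₛ-finite C C⊆T x [] (x∈ ∷ []) =
      let F , F∈C , x∈F = toWitness x∈ in F , F∈C , x∈F ∷ []
    ⋃ₛ-finite C C⊆T x (y ∷ ys) (x∈ ∷ ys∈) =
      let F , F∈C , x∈F  = toWitness x∈
          G , G∈C , ys∈G = ⋃ₛ-finite C C⊆T y ys ys∈
      in case tower-linear (C⊆T F∈C) (C⊆T G∈C) of λ where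
        (inj₁ F⊆G) → G , G∈C , F⊆G x∈F ∷ ys∈G
        (inj₂ G⊆F) → F , F∈C , x∈F ∷ All.map G⊆F ys∈G

    module _ (consistent-[] : Consistent []) where

      tower-consistent : ∀ {F} → F ∈ Tower → FinitelyConsistent F
      tower-consistent (step {F} F∈T) = go em
        where
        go : ∀ d → FinitelyConsistent (adjoin-chosen F d)
        go (yes ne) = proj₂ (proj₁ (proj₂ (ac A)) (Extends F) ne)
        go (no  _)  = tower-consistent F∈T
      tower-consistent (union C C⊆T) []       _   = consistent-[]
      tower-consistent (union C C⊆T) (x ∷ xs) xs∈ =
        let F , F∈C , xs∈F = ⋃ₛ-finite C C⊆T x xs xs∈
        in tower-consistent (C⊆T F∈C) (x ∷ xs) xs∈F

      -- The union of the whole tower is its largest member, so `next` adds nothing to it, whereas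
      -- it would adjoin a point if an extension remained.
      maximal : ∃[ M ] FinitelyConsistent M ×
                       (∀ x → FinitelyConsistent (adjoin x M) → x ∈ M)
      maximal = M , tower-consistent M∈T , λ x con →
        by-contradiction λ x∉M → no-extension em next-M⊆M (x , x∉M , con)
        where
        M : Subset
        M = ⋃ₛ (λ F → Resize (F ∈ Tower))

        M∈T : M ∈ Tower
        M∈T = union _ toWitness

        next-M⊆M : next M ⊆ M
        next-M⊆M = ⋃ₛ-upper _ (fromWitness (step M∈T))

        no-extension : ∀ d → adjoin-chosen M d ⊆ M → ¬ Satisfiable (Extends M)
        no-extension (no ¬ne) _  = ¬ne
        no-extension (yes ne) ⊆M _ =
          proj₁ (proj₁ (proj₂ (ac A)) (Extends M) ne)
            (⊆M (inj₂ (fromWitness refl)))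

  -- Tychonoff's theorem for closed families.

  module _ (ac : ∀ {a b} → AxiomOfChoice a b)
    {I : Set ℓ} (S : I → TopologicalSpace ℓ ℓ)
    (compact : ∀ i → TopologicalSpace.Compact (S i))
    {K : Set ℓ} (N : K → Pred (Point S) ℓ)
    (N-closed : ∀ k → TopologicalSpace.Closed (∏ S) (N k))
    (fip : ∀ ks → ∃[ s ] All (λ k → s ∈ N k) ks)
    where

    private
      module S i = TopologicalSpace (S i)

      Consistent : Pred (List (Cylinder S)) ℓ
      Consistent Zs = ∀ ks → ∃[ s ] All (λ k → s ∈ N k) ks × s ∈ box S Zs

      open Teichmüller–Tukey ac Consistent

      -- `Z` may occur repeatedly in the list; dropping all its occurrences leaves a list from `M`,
      -- and intersecting once with its cylinder restores the constraint.
      box-adjoin : ∀ {M Z} Zs → All (adjoin Z M) Zs →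
        ∃[ Ws ] All M Ws × cylinder S Z ∩ box S Ws ⊆ box S Zs
      box-adjoin [] [] = [] , [] , proj₂
      box-adjoin (Z ∷ Zs) (Z∈ ∷ Zs∈) with box-adjoin Zs Zs∈ | Z∈
      ... | Ws , Ws∈ , ⊆Zs | inj₁ Z∈M = Z ∷ Ws , Z∈M ∷ Ws∈ ,
        λ (s∈ , s∈Z , s∈Ws) → s∈Z , ⊆Zs (s∈ , s∈Ws)
      ... | Ws , Ws∈ , ⊆Zs | inj₂ eq with refl ← toWitness eq = Ws , Ws∈ ,
        λ (s∈ , s∈Ws) → s∈ , ⊆Zs (s∈ , s∈Ws)

    -- A point s whose basic neighbourhoods all consist of members of M lies in
    -- every N k, since otherwise some such neighbourhood would miss N k.
    Tychonoff : ∃[ s ] ∀ k → s ∈ N k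
    Tychonoff with maximal (λ ks → let s , s∈ = fip ks in s , s∈ , tt)
    ... | M , consistent , M-max = s , λ k → by-contradiction λ s∉N →
      let Zs , s∈Zs , Zs⊆∁N = N-closed k s s∉N
          t , t∈N , t∈Zs = consistent Zs (limit-box Zs s∈Zs) (k ∷ [])
      in Zs⊆∁N t∈Zs (All.head t∈N)
      where
      -- A cylinder carries its openness proof, so membership in `M` is demanded for every such
      -- proof.
      IsLimit : ∀ i → Pred (S.Carrier i) (lsuc ℓ)
      IsLimit i x = ∀ U (Uo : S.Open i U) → x ∈ U → (i , U , Uo) ∈ M

      -- A finite certificate of non-membership in `M` that, unlike non-membership itself, makes
      -- sense for finite unions of cylinders.
      Avoids : Pred (Pred (Point S) ℓ) (lsuc ℓ)
      Avoids P = ∃₂ λ Zs ks →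
        All M Zs × (∀ s → s ∈ box S Zs → All (λ k → s ∈ N k) ks → s ∉ P)

      -- By maximality, adjoining `Z` breaks consistency; the failing lists form the certificate
      -- once `box-adjoin` has removed `Z`.
      avoids-cylinder : ∀ Z → Z ∉ M → Avoids (cylinder S Z)
      avoids-cylinder Z Z∉M =
        let Zs , ¬con        = ¬∀⇒∃¬ (Z∉M ∘ M-max Z)
            Zs∈ , ¬con′      = ¬∀⇒∃¬ ¬con
            ks , ¬∃          = ¬∀⇒∃¬ ¬con′
            Ws , Ws∈ , Z∩Ws⊆ = box-adjoin Zs Zs∈
        in Ws , ks , Ws∈ , λ s s∈Ws s∈N s∈Z → ¬∃ (s , s∈N , Z∩Ws⊆ (s∈Z , s∈Ws))

      avoids-Any : {X : Set ℓ} (P : X → Pred (Point S) ℓ) →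
                   (∀ x → Avoids (P x)) →
                   ∀ xs → Avoids (λ s → Any (λ x → s ∈ P x) xs)
      avoids-Any P avoids [] = [] , [] , [] , λ _ _ _ ()
      avoids-Any P avoids (x ∷ xs) =
        let Zs , ks , Zs∈ , ∉Px  = avoids x
            Ws , ls , Ws∈ , ∉Pxs = avoids-Any P avoids xs
        in Zs ++ Ws , ks ++ ls , ++⁺ Zs∈ Ws∈ , λ where
          s s∈box s∈N (here s∈Px) →
            ∉Px s (proj₁ (box-++⁻ S Zs Ws s∈box)) (proj₁ (++⁻ ks s∈N)) s∈Px
          s s∈box s∈N (there s∈Pxs) →
            ∉Pxs s (proj₂ (box-++⁻ S Zs Ws s∈box)) (proj₂ (++⁻ ks s∈N)) s∈Pxs

      -- Otherwise every point has a neighbourhood whose cylinder is outside `M`. Finitely many of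
      -- these cover the factor, so their certificates combine to avoid every profile, against
      -- consistency of `M`.
      limit : ∀ i → Satisfiable (IsLimit i)
      limit i = by-contradiction λ ¬limit →
        let nbhd : ∀ x → ∃[ U ] Σ[ Uo ∈ S.Open i U ] x ∈ U × (i , U , Uo) ∉ M
            nbhd x =
              let U , ¬∀Uo   = ¬∀⇒∃¬ (λ lim → ¬limit (x , lim))
                  Uo , ¬∀x∈U = ¬∀⇒∃¬ ¬∀Uo
                  x∈U , ∉M   = ¬∀⇒∃¬ ¬∀x∈U
              in U , Uo , x∈U , ∉M
            xs , covers = compact i (S.Carrier i) (proj₁ ∘ nbhd)
              (λ x → proj₁ (proj₂ (nbhd x)))
              (λ x → x , proj₁ (proj₂ (proj₂ (nbhd x))))
            Zs , ks , Zs∈ , avoids = avoids-Any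
              (λ x s → s i ∈ proj₁ (nbhd x))
              (λ x → let U , Uo , _ , ∉M = nbhd x
                     in avoids-cylinder (i , U , Uo) ∉M)
              xs
            s , s∈N , s∈Zs = consistent Zs Zs∈ ks
        in avoids s s∈Zs s∈N (covers (s i))

      s : Point S
      s i = proj₁ (limit i)

      limit-box : ∀ Zs → s ∈ box S Zs → All M Zs
      limit-box []                  _            = []
      limit-box ((i , U , Uo) ∷ Zs) (s∈U , s∈Zs) =
        proj₂ (limit i) U Uo s∈U ∷ limit-box Zs s∈Zs

  -- Separation in compact preregular spaces.

  module _ (X : TopologicalSpace ℓ ℓ) where

    private
      module X = TopologicalSpace X

    ⋂-open : {A : Set a} {P : A → Pred (Pred X.Carrier ℓ) p} {x : X.Carrier} →
      (∀ α → ∃[ U ] X.Open U × x ∈ U × P α U) →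
      (∀ {α U V} → V ⊆ U → P α U → P α V) →
      ∀ αs → ∃[ U ] X.Open U × x ∈ U × All (λ α → P α U) αs
    ⋂-open nbhd mono [] = whole , X.whole-open , tt , []
    ⋂-open nbhd mono (α ∷ αs) =
      let U , Uo , x∈U , Pα  = nbhd α
          V , Vo , x∈V , Pαs = ⋂-open nbhd mono αs
      in U ∩ V , X.∩-open Uo Vo , (x∈U , x∈V) ,
         mono proj₁ Pα ∷ All.map (mono proj₂) Pαs

    -- The open set `∁ K` distinguishes `x` from each point of `K`, so preregularity applies.
    -- Compactness is used on `∁ K` together with the resulting neighbourhoods.
    separate : X.Preregular → X.Compact → ∀ {K x} → X.Closed K → x ∉ K →
      ∃₂ λ U V → X.Open U × X.Open V × x ∈ U × K ⊆ V × U ⊥ V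
    separate preregular compact {K} {x} K-closed x∉K =
      let αs , covers = compact (Maybe (∃ K)) cover cover-open covered
          U , Uo , x∈U , avoids = ⋂-open {P = Avoids} nbhd avoids-⊆ αs
          -- All neighbourhoods disjoint from `U` are united, not only those of the subcover, so
          -- disjointness is immediate.
          V = ⋃ (∃[ y ] U ⊥ sep-V y) (sep-V ∘ proj₁)
      in U , V , Uo , X.⋃-open _ _ (sep-V-open ∘ proj₁) , x∈U
         , (λ {z} z∈K → find z∈K avoids (covers z))
         , λ { (z∈U , (y , U⊥V) , z∈V) → U⊥V (z∈U , z∈V) }
      where
      sep : ((y , _) : ∃ K) →
            ∃₂ λ U V → X.Open U × X.Open V × x ∈ U × y ∈ V × U ⊥ V
      sep (y , y∈K) = preregular x y (∁ K , K-closed , inj₁ (x∉K , λ y∉K → y∉K y∈K))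

      sep-V : ∃ K → Pred X.Carrier ℓ
      sep-V y = proj₁ (proj₂ (sep y))

      sep-V-open : ∀ y → X.Open (sep-V y)
      sep-V-open y = let _ , _ , _ , Vo , _ = sep y in Vo

      cover : Maybe (∃ K) → Pred X.Carrier ℓ
      cover nothing  = ∁ K
      cover (just y) = sep-V y

      cover-open : ∀ α → X.Open (cover α)
      cover-open nothing  = K-closed
      cover-open (just y) = sep-V-open y

      covered : ∀ z → z ∈ ⋃ _ cover
      covered z with em {P = z ∈ K}
      ... | yes z∈K = let _ , _ , _ , _ , _ , z∈V , _ = sep (z , z∈K)
                      in just (z , z∈K) , z∈V
      ... | no  z∉K = nothing , z∉K

      Avoids : Maybe (∃ K) → Pred (Pred X.Carrier ℓ) ℓ
      Avoids α U = ∀ y → α ≡ just y → U ⊥ sep-V y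

      avoids-⊆ : ∀ {α U V} → V ⊆ U → Avoids α U → Avoids α V
      avoids-⊆ V⊆U avoids y eq (z∈V , z∈) = avoids y eq (V⊆U z∈V , z∈)

      nbhd : ∀ α → ∃[ U ] X.Open U × x ∈ U × Avoids α U
      nbhd nothing  = whole , X.whole-open , tt , λ _ ()
      nbhd (just y) = let U , _ , Uo , _ , x∈U , _ , U⊥V = sep y
                      in U , Uo , x∈U , λ { _ refl → U⊥V }

      find : ∀ {U z αs} → z ∈ K → All (λ α → Avoids α U) αs →
             Any (λ α → z ∈ cover α) αs → z ∈ ⋃ (∃[ y ] U ⊥ sep-V y) (sep-V ∘ proj₁)
      find {αs = nothing ∷ _} z∈K _ (here z∉K) = contradiction z∈K z∉K
      find {αs = just y ∷ _} z∈K (avoids ∷ _) (here z∈V) = (y , avoids y refl) , z∈V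
      find z∈K (_ ∷ avoids) (there z∈) = find z∈K avoids z∈

  module _ {I : Set ℓ} (S : I → TopologicalSpace ℓ ℓ) where

    box-resp-≗ : ∀ Zs {s t : Point S} → (∀ i → s i ≡ t i) →
                 s ∈ box S Zs → t ∈ box S Zs
    box-resp-≗ []                 s≗t _            = tt
    box-resp-≗ ((i , U , _) ∷ Zs) s≗t (s∈U , s∈Zs) =
      subst U (s≗t i) s∈U , box-resp-≗ Zs s≗t s∈Zs

    ∏-open-resp-≗ : ∀ {U} → TopologicalSpace.Open (∏ S) U →
                    ∀ {s t : Point S} → (∀ i → s i ≡ t i) → s ∈ U → t ∈ U
    ∏-open-resp-≗ Uo {s} s≗t s∈U =
      let Zs , s∈Zs , Zs⊆U = Uo s s∈U in Zs⊆U (box-resp-≗ Zs s≗t s∈Zs)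

  -- Membership proofs are irrelevant and must be recomputed, possibly as another occurrence;
  -- uniqueness forces the original index.
  list-finite : {A : Set a} (xs : List A) → Unique xs →
                Finite [ x ∈ A ∣ x ∈ˡ xs ]
  list-finite xs unique = _ , mk↔ₛ′
    (λ k → lookup xs k , [ ∈-lookup k ])
    (λ (_ , [ x∈ ]) → Any.index (recompute em x∈))
    (λ (_ , [ x∈ ]) → value-injective (sym (lookup-index (recompute em x∈))))
    (λ k → let k∈ = recompute em (∈-lookup {xs = xs} k)
           in lookup-injective unique (Any.index k∈) k (sym (lookup-index k∈)))

  -- Closedness of the best-response conditions.

  module _ (G : Game ℓ) (well-specified : WellSpecified G) where

    open Game G
    open WellSpecified well-specified

    private
      module S i  = TopologicalSpace (S i)
      module ∏₋S i = TopologicalSpace (∏₋ S i)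
      module BR i = ContinuousMap (BR i)

    -- Once `x` is separated from the closed set of best responses to `t`, `W` is the preimage under
    -- `BR` of the basic upper Vietoris set given by `V`.
    separate-graph : ∀ i {t x} → x ∉ bestResponses i t →
      ∃₂ λ W U → ∏₋S.Open i W × S.Open i U × t ∈ W × x ∈ U ×
        (∀ {t′ x′} → t′ ∈ W → x′ ∈ U → x′ ∉ bestResponses i t′)
    separate-graph i {t} x∉ =
      let U , V , Uo , Vo , x∈U , K⊆V , U⊥V = separate (S i) (preregular i)
            (compact i) (ClosedSubset.closed (BR.to i t)) x∉
      in (BR.to i ⊢ subsetsOf (S i) (V , Vo)) , U
         , BR.continuous i (subsetsOf (S i) (V , Vo))
             (λ _ K′⊆V → (V , Vo) , K′⊆V , id)
         , Uo , K⊆V , x∈U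
         , λ K′⊆V x′∈U x′∈K′ → U⊥V (x′∈U , K′⊆V x′∈K′)

    -- Without function extensionality, BR need not preserve pointwise equality
    -- on the nose, but pointwise equal points are topologically
    -- indistinguishable.
    bestResponses-resp-≗ : ∀ i {t t′} → (∀ j → t j ≡ t′ j) →
                           bestResponses i t ⊆ bestResponses i t′
    bestResponses-resp-≗ i t≗t′ x∈ = by-contradiction λ x∉ →
      let W , U , Wo , _ , t′∈W , x∈U , disjoint = separate-graph i x∉
          t∈W = ∏-open-resp-≗ (λ j → S (value j)) Wo (λ j → sym (t≗t′ j)) t′∈W
      in disjoint t∈W x∈U x∈

    BestResponds : Player → Pred Profile ℓ
    BestResponds i s = s i ∈ bestResponses i (s ₋ i)

    BestResponds-closed : ∀ i → TopologicalSpace.Closed (∏ S) (BestResponds i)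
    BestResponds-closed i s s∉ =
      let W , U , Wo , Uo , s∈W , s∈U , disjoint = separate-graph i s∉
          Zs , s∈Zs , Zs⊆ = TopologicalSpace.∩-open (∏ S)
            (ContinuousMap.continuous restrict W Wo)
            (ContinuousMap.continuous (π S i) U Uo)
            s (s∈W , s∈U)
      in Zs , s∈Zs , λ t∈Zs → let t∈W , t∈U = Zs⊆ t∈Zs in disjoint t∈W t∈U
      where
      restrict : ContinuousMap (∏ S) (∏₋ S i)
      restrict = ⟨ (λ j → S (value j)) ⟩ λ j → π S (value j)

    -- From equilibria of reductions to profiles of the whole game.

    module _ (J : Pred Player ℓ) (J? : Decidable J) where

      open Reduction G J J?

      module _ (p : Point S₋ᴶ) (q : Point Sᴶ) where

        glue : ∀ i → Dec (i ∈ J) → S.Carrier i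
        glue i (yes i∈J) = q (i , [ i∈J ])
        glue i (no  i∉J) = p (i , [ i∉J ])

        glueAll : Profile
        glueAll i = glue i (J? i)

        glue-inside : ∀ {i} (i∈J : i ∈ J) → q (i , [ i∈J ]) ≡ glueAll i
        glue-inside {i} i∈J with J? i
        ... | yes _   = refl
        ... | no  i∉J = contradiction i∈J i∉J

        glue-others : ∀ i j → ContinuousMap.to (extend p i) (λ k → q (value k)) j
                              ≡ (glueAll ₋ value i) j
        glue-others i (j , j≢i) with J? j
        ... | yes _ = refl
        ... | no  _ = refl

        -- The reduced game evaluates `BR` at `extend p`, which is known to agree with the glued
        -- profile only pointwise, hence `bestResponses-resp-≗`.
        reduction-nash : ∀ two → Game.IsNash (reduction p two) q →
                         ∀ {i} → i ∈ J → BestResponds i glueAll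
        reduction-nash two nash {i} i∈J =
          subst (_∈ bestResponses i (glueAll ₋ i)) (glue-inside i∈J)
            (bestResponses-resp-≗ i (glue-others (i , [ i∈J ]))
              (nash (i , [ i∈J ])))

    finitely-BestResponds : ∀ is → ∃[ s ] All (λ i → BestResponds i s) is
    finitely-BestResponds is =
      let u , v , u≢v = twoPlayers
          -- `u` and `v` ensure two players even for short `is`; removing duplicates lets
          -- `list-finite` apply.
          js = deduplicate (λ _ _ → em) (u ∷ v ∷ is)
          J = _∈ˡ js
          ∈J : ∀ {i} → i ∈ˡ (u ∷ v ∷ is) → i ∈ J
          ∈J = ∈-deduplicate⁺ (λ _ _ → em)
          two = (u , [ ∈J (here refl) ]) , (v , [ ∈J (there (here refl)) ]) ,
                u≢v ∘ cong value
          -- The players outside `J` may play anything, as only those in `is` must best respond.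
          p = λ i → S-nonempty (value i)
          q , nash = finiteNash J (λ _ → em) two
            (list-finite js (deduplicate-! (λ _ _ → em) (u ∷ v ∷ is))) p
      in glueAll J (λ _ → em) p q
         , All.tabulate λ i∈ →
             reduction-nash J (λ _ → em) p q two nash (∈J (there (there i∈)))

theorem4 : (∀ {a} → ExcludedMiddle a) →
    (∀ {a b} → AxiomOfChoice a b) →
    ∀ {ℓ} (G : Game ℓ) → WellSpecified G →
    ∃[ s ] Game.IsNash G s
theorem4 em ac G ws =
  Tychonoff em ac (Game.S G) (WellSpecified.compact ws)
    (BestResponds em G ws) (BestResponds-closed em G ws)
    (finitely-BestResponds em G ws)
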